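{- For every finite set $\mathcal{D}$ of finite directed graphs there is a finite set $\mathcal{F}$ of finite directed graphs such that $(\mathcal{F},\mathcal{D})$ is a generalized finite F-duality pair, i.e. for every finite directed graph $G$: there exists $F\in\mathcal{F}$ with a full homomorphism $F\to G$ if and only if there is no $D\in\mathcal{D}$ with a full homomorphism $G\to D$.
   Context: Directed graphs are finite, loops allowed (the empty graph is also allowed). A full homomorphism $f:G\to H$ is a map $f:V_G\to V_H$ such that $(u,v)\in E_G\iff (f(u),f(v))\in E_H$ for all $u,v\in V_G$. -}

module Defs where

open import Data.Bool.Base using (Bool; T)
open import Data.Fin.Base using (Fin)
open import Data.List.Base using (List)
open import Data.List.Relation.Unary.Any using (Any)
open import Data.Nat.Base using (ℕ)
open import Data.Product.Base using (Σ-syntax)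
open import Function.Bundles using (_⇔_)
open import Relation.Nullary.Negation.Core using (¬_)

-- Every finite vertex set is represented, up to relabelling, by some Fin n.
-- The Bool-valued adjacency makes the edge set a (decidable) subset of V × V.
record Digraph : Set where
  constructor digraph
  field
    order : ℕ
    adj   : Fin order → Fin order → Bool

  V : Set
  V = Fin order

  E : V → V → Set
  E u v = T (adj u v)

open Digraph public using (V; E)

IsFullHom : (G H : Digraph) → (V G → V H) → Set
IsFullHom G H f = ∀ u v → E G u v ⇔ E H (f u) (f v)

infix 4 _⟶ᶠ_

_⟶ᶠ_ : Digraph → Digraph → Set
G ⟶ᶠ H = Σ[ f ∈ (V G → V H) ] IsFullHom G H f

-- Finite sets of digraphs are lists; order and repetition play no role, since
-- a list is only ever used through the existence of a member with a property.
IsGeneralizedFiniteFDualityPair : List Digraph → List Digraph → Set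
IsGeneralizedFiniteFDualityPair 𝓕 𝓓 =
  ∀ (G : Digraph) → Any (λ F → F ⟶ᶠ G) 𝓕 ⇔ (¬ Any (λ D → G ⟶ᶠ D) 𝓓)

{-# OPTIONS --safe #-}

-- Vertices are twins if they have the same in- and out-neighbours; a full
-- homomorphism identifies only twins.  Let n exceed the orders of all members
-- of 𝓓.  Either G has n pairwise non-twin vertices, and these, together with a
-- vertex separating each pair of them, induce a subgraph of order at most
-- n + n * n that maps to no member of 𝓓; or at most n vertices represent all
-- twin classes, and G maps to the subgraph they induce.  So the digraphs
-- of order at most n + n * n that map to no member of 𝓓 are the required
-- obstructions.
module Submission where

open import Defs
open import Data.List.Base using (List; map; filter; concatMap; allFin; upTo)
open import Data.Product.Base using (∃-syntax; _×_; _,_; proj₁; proj₂; uncurry)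
open import Data.Bool.Base using (Bool; T)
open import Data.Bool.Properties using (T-≡; ⇔→≡) renaming (_≟_ to _≟ᵇ_)
open import Data.Fin.Base
  using (Fin; zero; suc; _<_; _↑ˡ_; _↑ʳ_; combine; remQuot; finToFun; funToFin)
open import Data.Fin.Properties
  using (2↔Bool; all?; any?; ¬∀⟶∃¬; pigeonhole; remQuot-combine; finToFun-funToFin)
open import Data.List.Extrema.Nat using (max; xs≤max)
open import Data.List.Membership.Propositional using (_∈_; find; lose)
open import Data.List.Membership.Propositional.Properties
  using (∈-map⁺; ∈-filter⁺; ∈-filter⁻; ∈-concatMap⁺; ∈-allFin; ∈-upTo⁺)
open import Data.List.Relation.Unary.All using (lookup)
open import Data.List.Relation.Unary.All.Properties using (map⁻)
open import Data.List.Relation.Unary.Any as Any using (Any)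
open import Data.Nat.Base as ℕ using (ℕ; zero; suc; _≤_; _+_; _*_; _^_; s≤s)
open import Data.Nat.Properties using (≤-refl; ≤-trans; m≤n⇒m≤1+n; m≤m+n)
open import Data.Sum.Base using (_⊎_; inj₁; inj₂)
open import Data.Vec.Functional using (Vector; _∷_; _++_)
open import Data.Vec.Functional.Properties using (lookup-++ˡ; lookup-++ʳ)
open import Function.Base using (_∘_; id)
open import Function.Bundles using (_⇔_; mk⇔; Inverse)
open import Function.Properties.Equivalence using () renaming (trans to ⇔-trans; sym to ⇔-sym)
open import Relation.Binary.PropositionalEquality
  using (_≡_; refl; sym; trans; cong; cong₂; subst; subst₂)
open import Relation.Nullary using (¬_; Dec; yes; no; contradiction; ¬?)
open import Relation.Nullary.Decidable using (map′; _×-dec_; decidable-stable)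

open Digraph using (order; adj)

PreservesAdj : (G H : Digraph) → (V G → V H) → Set
PreservesAdj G H f = ∀ u v → adj G u v ≡ adj H (f u) (f v)

toFullHom : ∀ G H {f} → PreservesAdj G H f → G ⟶ᶠ H
toFullHom G H {f} p = f , λ u v →
  subst (λ b → E G u v ⇔ T b) (p u v) (mk⇔ id id)

fullHom-preservesAdj : ∀ G H ((f , _) : G ⟶ᶠ H) → PreservesAdj G H f
fullHom-preservesAdj G H (f , full) u v =
  ⇔→≡ (⇔-trans (⇔-sym T-≡) (⇔-trans (full u v) T-≡))

fullHom-trans : ∀ G H K → G ⟶ᶠ H → H ⟶ᶠ K → G ⟶ᶠ K
fullHom-trans G H K (f , p) (g , q) = g ∘ f , λ u v → ⇔-trans (p u v) (q (f u) (f v))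

-- Maps between finite vertex sets have finitely many codes, so all can be searched. Decoding
-- recovers a map pointwise, which is enough for adjacency.
_⟶ᶠ?_ : ∀ G H → Dec (G ⟶ᶠ H)
G ⟶ᶠ? H = map′
  (λ (_ , p) → toFullHom G H p)
  (λ φ@(f , _) → funToFin f , λ u v →
    trans (fullHom-preservesAdj G H φ u v)
          (sym (cong₂ (adj H) (finToFun-funToFin f u) (finToFun-funToFin f v))))
  (any? λ c → all? λ u → all? λ v →
    adj G u v ≟ᵇ adj H (finToFun c u) (finToFun c v))

-- The code is the adjacency matrix read as `k * k` bits, so the digraphs of order `k` can be listed
-- through `Fin`.
digraphFromCode : ∀ k → Fin (2 ^ (k * k)) → Digraph
digraphFromCode k c = digraph k λ u v → Inverse.to 2↔Bool (finToFun c (combine u v))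

digraphCode : ∀ {k} → (Fin k → Fin k → Bool) → Fin (2 ^ (k * k))
digraphCode {k} a = funToFin (Inverse.from 2↔Bool ∘ uncurry a ∘ remQuot {k} k)

digraphFromCode-code : ∀ {k} (a : Fin k → Fin k → Bool) u v →
                       adj (digraphFromCode k (digraphCode a)) u v ≡ a u v
digraphFromCode-code {k} a u v = trans
  (cong (Inverse.to 2↔Bool) (trans
    (finToFun-funToFin _ (combine u v))
    (cong (Inverse.from 2↔Bool ∘ uncurry a) (remQuot-combine u v))))
  (Inverse.inverseˡ 2↔Bool refl)

digraphsUpTo : ℕ → List Digraph
digraphsUpTo N = concatMap (λ k → map (digraphFromCode k) (allFin _)) (upTo (suc N))

∈-digraphsUpTo : ∀ {N k} → k ≤ N → ∀ c → digraphFromCode k c ∈ digraphsUpTo N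
∈-digraphsUpTo k≤N c =
  ∈-concatMap⁺ (λ k → map (digraphFromCode k) (allFin _))
    (lose (∈-upTo⁺ (s≤s k≤N)) (∈-map⁺ _ (∈-allFin c)))

-- Decoding the code of `F` gives pointwise equal adjacency, so the identity on vertices is a full
-- homomorphism both ways. Only such maps matter for duality.
digraphsUpTo-complete : ∀ {N} F → order F ≤ N →
                        ∃[ F′ ] F′ ∈ digraphsUpTo N × (F′ ⟶ᶠ F) × (F ⟶ᶠ F′)
digraphsUpTo-complete F ≤N =
  F′ , ∈-digraphsUpTo ≤N (digraphCode (adj F))
     , toFullHom F′ F (digraphFromCode-code (adj F))
     , toFullHom F F′ (λ u v → sym (digraphFromCode-code (adj F) u v))
  where F′ = digraphFromCode (order F) (digraphCode (adj F))

-- h need not be injective.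
induced : ∀ G {k} → Vector (V G) k → Digraph
induced G {k} h = digraph k λ i j → adj G (h i) (h j)

module Twins (G : Digraph) where

  AgreeAt : V G → V G → V G → Set
  AgreeAt u v w = adj G u w ≡ adj G v w × adj G w u ≡ adj G w v

  Twin : V G → V G → Set
  Twin u v = ∀ w → AgreeAt u v w

  agreeAt? : ∀ u v w → Dec (AgreeAt u v w)
  agreeAt? u v w = (adj G u w ≟ᵇ adj G v w) ×-dec (adj G w u ≟ᵇ adj G w v)

  twin? : ∀ u v → Dec (Twin u v)
  twin? u v = all? (agreeAt? u v)

  -- Twins get an arbitrary vertex, here `u`, so that a witness exists for every pair and can be
  -- tabulated.
  separator : ∀ u v → ∃[ w ] (AgreeAt u v w → Twin u v)
  separator u v with twin? u v
  ... | yes t = u , λ _ → t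
  ... | no ¬t with w , ¬agree ← ¬∀⟶∃¬ _ _ (agreeAt? u v) ¬t =
    w , λ agree → contradiction agree ¬agree

  PairwiseNonTwin : ∀ {k} → Vector (V G) k → Set
  PairwiseNonTwin h = ∀ i j → i < j → ¬ Twin (h i) (h j)

  Represents : ∀ {k} → Vector (V G) k → Set
  Represents h = ∀ v → ∃[ i ] Twin v (h i)

  -- Greedy choice: add a vertex that is no twin of those chosen; when none exists, the chosen ones
  -- represent every vertex.
  representatives⊎nonTwins : ∀ n →
    (∃[ k ] k ≤ n × ∃[ h ] Represents {k} h) ⊎ (∃[ h ] PairwiseNonTwin {n} h)
  representatives⊎nonTwins zero = inj₂ ((λ ()) , λ ())
  representatives⊎nonTwins (suc n) with representatives⊎nonTwins n
  ... | inj₁ (k , k≤n , rep) = inj₁ (k , m≤n⇒m≤1+n k≤n , rep)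
  ... | inj₂ (h , nonTwin) with any? (λ v → all? (λ i → ¬? (twin? v (h i))))
  ...   | yes (v , new) = inj₂ (v ∷ h , λ where
            zero    (suc j) _         → new j
            (suc i) (suc j) (s≤s i<j) → nonTwin i j i<j)
  ...   | no ¬new = inj₁ (n , m≤n⇒m≤1+n ≤-refl , h , λ v →
            decidable-stable (any? (λ i → twin? v (h i)))
              (λ ¬rep → ¬new (v , λ i t → ¬rep (i , t))))

  -- Send each vertex to its representative: replacing first `u`, then `v`, by a twin leaves the
  -- adjacency of `u` and `v` unchanged.
  represents⇒fullHom : ∀ {k} {h : Vector (V G) k} → Represents h → G ⟶ᶠ induced G h
  represents⇒fullHom {h = h} rep = toFullHom G (induced G h) λ u v →
    trans (proj₁ (proj₂ (rep u) v)) (proj₂ (proj₂ (rep v) _))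

open Twins

fullHom-identifies-twins : ∀ G H ((f , _) : G ⟶ᶠ H) {u v} → f u ≡ f v → Twin G u v
fullHom-identifies-twins G H φ@(f , _) {u} {v} fu≡fv w =
    trans (p u w) (trans (cong (λ x → adj H x (f w)) fu≡fv) (sym (p v w)))
  , trans (p w u) (trans (cong (adj H (f w)) fu≡fv) (sym (p w v)))
  where p = fullHom-preservesAdj G H φ

module _ (G : Digraph) {n : ℕ} (h : Vector (V G) n) where

  separators : Vector (V G) (n * n)
  separators x = let i , j = remQuot {n} n x in proj₁ (separator G (h i) (h j))

  withSeparators : Vector (V G) (n + n * n)
  withSeparators = h ++ separators

  -- The separator of `h i` and `h j` is itself a vertex of the subgraph; agreement there already
  -- forces them to be twins in `G`.
  withSeparators-twin : ∀ i j → Twin (induced G withSeparators) (i ↑ˡ n * n) (j ↑ˡ n * n) →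
                        Twin G (h i) (h j)
  withSeparators-twin i j twin = proj₂ (separator G (h i) (h j))
    (subst (AgreeAt G (h i) (h j)) sepEq
      (subst₂ (λ u v → AgreeAt G u v (withSeparators x))
        (lookup-++ˡ h separators i) (lookup-++ˡ h separators j) (twin x)))
    where
    x = n ↑ʳ combine i j

    sepEq : withSeparators x ≡ proj₁ (separator G (h i) (h j))
    sepEq = trans (lookup-++ʳ h separators (combine i j))
      (cong (λ (i , j) → proj₁ (separator G (h i) (h j))) (remQuot-combine i j))

  -- By pigeonhole two of the first `n` vertices share an image, hence are twins in the subgraph and
  -- so in `G`.
  nonTwins⇒¬fullHom : PairwiseNonTwin G h → ∀ D → order D ℕ.< n →
                      ¬ (induced G withSeparators ⟶ᶠ D)
  nonTwins⇒¬fullHom nonTwin D D<n φ@(f , _)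
    with i , j , i<j , fi≡fj ← pigeonhole D<n (f ∘ (_↑ˡ n * n)) =
    nonTwin i j i<j (withSeparators-twin i j
      (fullHom-identifies-twins (induced G withSeparators) D φ fi≡fj))

-- `F` stands in for `G` against all targets of order below `n`, with a size bound independent of
-- `G`. In the second case `F` has no such target.
boundedTestDigraph : ∀ n G → ∃[ F ] order F ≤ n + n * n × (F ⟶ᶠ G) ×
                     (∀ D → order D ℕ.< n → F ⟶ᶠ D → G ⟶ᶠ D)
boundedTestDigraph n G with representatives⊎nonTwins G n
... | inj₁ (k , k≤n , h , rep) =
  induced G h , ≤-trans k≤n (m≤m+n n _) , toFullHom (induced G h) G (λ _ _ → refl) ,
  λ D _ → fullHom-trans G (induced G h) D (represents⇒fullHom G rep)
... | inj₂ (h , nonTwin) =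
  F , ≤-refl , toFullHom F G (λ _ _ → refl) ,
  λ D D<n φ → contradiction φ (nonTwins⇒¬fullHom G h nonTwin D D<n)
  where F = induced G (withSeparators G h)

theorem5p5p7 : ∀ (𝓓 : List Digraph) → ∃[ 𝓕 ] IsGeneralizedFiniteFDualityPair 𝓕 𝓓
theorem5p5p7 𝓓 = 𝓕 , λ G → mk⇔ (sound G) (complete G)
  where
  Maps : Digraph → Set
  Maps G = Any (G ⟶ᶠ_) 𝓓

  nonMapping? : ∀ G → Dec (¬ Maps G)
  nonMapping? G = ¬? (Any.any? (G ⟶ᶠ?_) 𝓓)

  n : ℕ
  -- The successor makes every order strictly smaller than `n`, as pigeonhole requires; `0` covers
  -- empty `𝓓`.
  n = suc (max 0 (map order 𝓓))

  order<n : ∀ {D} → D ∈ 𝓓 → order D ℕ.< n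
  order<n D∈𝓓 = s≤s (lookup (map⁻ (xs≤max 0 (map order 𝓓))) D∈𝓓)

  𝓕 : List Digraph
  𝓕 = filter nonMapping? (digraphsUpTo (n + n * n))

  sound : ∀ G → Any (_⟶ᶠ G) 𝓕 → ¬ Maps G
  sound G F⟶G G↦𝓓 with F , F∈𝓕 , φ ← find F⟶G =
    proj₂ (∈-filter⁻ nonMapping? {xs = digraphsUpTo (n + n * n)} F∈𝓕)
      (Any.map (λ {D} → fullHom-trans F G D φ) G↦𝓓)

  -- The listed copy `F′` of the test digraph of `G` passes the filter: a map from it to some `D` in
  -- `𝓓` would yield one from `G`.
  complete : ∀ G → ¬ Maps G → Any (_⟶ᶠ G) 𝓕
  complete G ¬G↦𝓓
    with F , F≤ , F⟶G , reflects ← boundedTestDigraph n G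
    with F′ , F′∈ , F′⟶F , F⟶F′ ← digraphsUpTo-complete F F≤ =
    lose (∈-filter⁺ nonMapping? F′∈ ¬F′↦𝓓) (fullHom-trans F′ F G F′⟶F F⟶G)
    where
    ¬F′↦𝓓 : ¬ Maps F′
    ¬F′↦𝓓 F′↦𝓓 with D , D∈𝓓 , φ ← find F′↦𝓓 =
      ¬G↦𝓓 (lose D∈𝓓 (reflects D (order<n D∈𝓓) (fullHom-trans F F′ D F⟶F′ φ)))
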